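{- Let $\phi$ be a De Morgan formula over $x_1,\dots,x_n$ of size $s$ and depth $d$, and let $\mathbf{p}$ be a $q$-fixing random projection from $x_1,\dots,x_n$ to $y_1,\dots,y_m$. Then \[\mathbb{E}\left[L(\phi|_{\mathbf{p}})\right]=O\!\left(q^2\cdot d^2\cdot s+q\cdot\sqrt{s}\right),\] where the constant in the $O(\cdot)$ is absolute.
   Context: A De Morgan formula is a binary tree whose leaves are labeled by literals $x_i,\overline{x_i}$ and internal nodes by AND/OR; size is the number of leaves and depth the depth of the tree. $L(f)$ denotes the minimal size of a formula computing $f$ ($L$ of a constant function is $0$); for a formula $\phi$, $L(\phi)$ is $L$ of the function it computes. A projection $\pi$ from $x_1,\dots,x_n$ to $y_1,\dots,y_m$ is a map $\{x_1,\dots,x_n\}\to\{0,1,y_1,\overline{y_1},\dots,y_m,\overline{y_m}\}$; $f|_\pi$ is the function of $y_1,\dots,y_m$ obtained by substituting $\pi(x_i)$ for each $x_i$. A random projection is a distribution over projections. For a projection $\pi$, a variable $y_j$ and $\sigma\in\{0,1\}$, $\pi_{y_j\gets\sigma}$ is the projection obtained from $\pi$ by substituting $y_j$ with $\sigma$; for a literal $\ell$, $\mathrm{var}(\ell)$ is its underlying variable. For $0\le q_0,q_1\le 1$, a random projection $\mathbf{p}$ is $(q_0,q_1)$-fixing if for every projection $\pi$, every $\sigma\in\{0,1\}$ and every variable $x_i$, \[\Pr[\mathbf{p}(x_i)\notin\{0,1\}\text{ and }\mathbf{p}_{\mathrm{var}(\mathbf{p}(x_i))\gets\sigma}=\pi]\le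 q_\sigma\cdot\Pr[\mathbf{p}=\pi].\] $\mathbf{p}$ is called $q$-fixing if it is $(q_0,q_1)$-fixing for some $q_0,q_1$ with $q=\sqrt{q_0q_1}$.
   Formalization: The probabilities of the random projection and the parameters q_0, q_1 are taken to be rational; the term q√s is expressed by a rational t ≥ 0 with t² ≤ q_0 q_1 s, which implies the stated bound. -}

module Defs where

open import Data.Nat as ℕ using (ℕ; zero; suc; _⊔_)
open import Data.Fin using (Fin; _≟_)
open import Data.Bool using (Bool; true; false; not; _∧_; _∨_; _xor_; if_then_else_)
open import Data.Vec using (Vec; []; _∷_; lookup; map)
open import Data.List using (List; []; _∷_)
open import Data.Product using (_×_; _,_; Σ; ∃)
open import Data.Sum using (_⊎_)
open import Data.Integer using (+_)
open import Data.Rational using (ℚ; _/_; 0ℚ; 1ℚ; _+_; _*_; _≤_)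
open import Relation.Nullary using (¬_; does)
open import Relation.Binary.PropositionalEquality using (_≡_)
open import Data.List.Relation.Unary.All using (All)

-- De Morgan formulas over variables x_0 .. x_{n-1}
-- A literal is (variable index, polarity); polarity true = x_i, false = ¬x_i.

data Formula (n : ℕ) : Set where
  leaf : Fin n → Bool → Formula n
  and  : Formula n → Formula n → Formula n
  or   : Formula n → Formula n → Formula n

size : ∀ {n} → Formula n → ℕ
size (leaf _ _) = 1
size (and φ ψ)  = size φ ℕ.+ size ψ
size (or φ ψ)   = size φ ℕ.+ size ψ

depth : ∀ {n} → Formula n → ℕ
depth (leaf _ _) = 0
depth (and φ ψ)  = suc (depth φ ⊔ depth ψ)
depth (or φ ψ)   = suc (depth φ ⊔ depth ψ)

litVal : Bool → Bool → Bool
litVal true  b = b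
litVal false b = not b

eval : ∀ {n} → Formula n → (Fin n → Bool) → Bool
eval (leaf i p) a = litVal p (a i)
eval (and φ ψ) a  = eval φ a ∧ eval ψ a
eval (or φ ψ) a   = eval φ a ∨ eval ψ a

BoolFun : ℕ → Set
BoolFun m = (Fin m → Bool) → Bool

Computes : ∀ {m} → Formula m → BoolFun m → Set
Computes ψ f = ∀ a → eval ψ a ≡ f a

Constant : ∀ {m} → BoolFun m → Set
Constant f = ∃ λ b → ∀ a → f a ≡ b

IsL : ∀ {m} → BoolFun m → ℕ → Set
IsL f k =
  (Constant f × k ≡ 0) ⊎
  (¬ Constant f × Σ (Formula _) (λ ψ → Computes ψ f × size ψ ≡ k)
                × (∀ ψ → Computes ψ f → k ℕ.≤ size ψ))

data Target (m : ℕ) : Set where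
  const : Bool → Target m
  lit   : Fin m → Bool → Target m

Projection : ℕ → ℕ → Set
Projection n m = Vec (Target m) n

applyT : ∀ {m} → Target m → (Fin m → Bool) → Bool
applyT (const b) a = b
applyT (lit j p) a = litVal p (a j)

restrict : ∀ {n m} → Formula n → Projection n m → BoolFun m
restrict φ π a = eval φ (λ i → applyT (lookup π i) a)

substT : ∀ {m} → Fin m → Bool → Target m → Target m
substT j σ (const b) = const b
substT j σ (lit j' p) = if does (j' ≟ j) then const (litVal p σ) else lit j' p

subst : ∀ {n m} → Projection n m → Fin m → Bool → Projection n m
subst π j σ = map (substT j σ) π

eqB : Bool → Bool → Bool
eqB true true = true
eqB false false = true
eqB _ _ = false

eqT : ∀ {m} → Target m → Target m → Bool
eqT (const b) (const c) = eqB b c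
eqT (lit j p) (lit k r) = does (j ≟ k) ∧ eqB p r
eqT _ _ = false

eqP : ∀ {n m} → Projection n m → Projection n m → Bool
eqP [] [] = true
eqP (s ∷ π) (t ∷ ρ) = eqT s t ∧ eqP π ρ

Dist : ℕ → ℕ → Set
Dist n m = List (Projection n m × ℚ)

totalWeight : ∀ {n m} → Dist n m → ℚ
totalWeight [] = 0ℚ
totalWeight ((_ , w) ∷ d) = w + totalWeight d

IsDist : ∀ {n m} → Dist n m → Set
IsDist d = All (λ e → 0ℚ ≤ Data.Product.proj₂ e) d × totalWeight d ≡ 1ℚ

Pr : ∀ {n m} → Dist n m → (Projection n m → Bool) → ℚ
Pr [] E = 0ℚ
Pr ((π , w) ∷ d) E = (if E π then w else 0ℚ) + Pr d E

Exp : ∀ {n m} → Dist n m → (Projection n m → ℕ) → ℚ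
Exp [] g = 0ℚ
Exp ((π , w) ∷ d) g = w * ((+ g π) / 1) + Exp d g

fixEvent : ∀ {n m} → Fin n → Bool → Projection n m → Projection n m → Bool
fixEvent i σ π p with lookup p i
... | const _ = false
... | lit j _ = eqP (subst p j σ) π

qσ : ℚ → ℚ → Bool → ℚ
qσ q0 q1 false = q0
qσ q0 q1 true  = q1

Fixing : ∀ {n m} → ℚ → ℚ → Dist n m → Set
Fixing {n} {m} q0 q1 d =
  ∀ (π : Projection n m) (σ : Bool) (i : Fin n) →
    Pr d (fixEvent i σ π) ≤ qσ q0 q1 σ * Pr d (eqP π)

ℕtoℚ : ℕ → ℚ
ℕtoℚ k = (+ k) / 1

{-# OPTIONS --safe #-}
module Submission where

open import Defs
open import Data.Bool using (Bool; true; false; not; _∧_; _∨_; if_then_else_)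
import Data.Bool.Properties as Bool
open import Data.Empty using (⊥)
open import Data.Fin using (Fin; _≟_)
open import Data.Fin.Subset.Properties using (anySubset?)
import Data.Integer as ℤ
import Data.Integer.Properties as ℤ
open import Data.List using (List; []; _∷_; allFin; cartesianProductWith)
open import Data.List.Membership.Propositional using (_∈_)
open import Data.List.Membership.Propositional.Properties using (∈-allFin; ∈-cartesianProductWith⁺)
open import Data.List.Relation.Unary.All using (All; []; _∷_)
open import Data.List.Relation.Unary.Any using (here; there)
open import Data.Maybe using (Maybe; just; nothing)
open import Data.Nat as ℕ using (ℕ; zero; suc; z≤n; s≤s)
import Data.Nat.Properties as ℕ
open import Data.Product using (Σ; _×_; _,_; proj₁; proj₂)
open import Data.Rational using (ℚ; 0ℚ; 1ℚ; _+_; _*_; _-_; -_; _≤_; _<_; nonNegative; positive; toℚᵘ)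
open import Data.Rational.Properties hiding (_≟_)
open import Data.Rational.Solver using (module +-*-Solver)
import Data.Rational.Unnormalised as ℚᵘ
import Data.Rational.Unnormalised.Properties as ℚᵘ
open import Data.Sum using (_⊎_; inj₁; inj₂)
open import Data.Vec using ([]; _∷_; lookup; tabulate)
open import Data.Vec.Properties using (lookup-map; lookup∘tabulate)
open import Relation.Nullary using (¬_; Dec; does; yes; no; ¬?; contradiction)
open import Relation.Nullary.Decidable using (decidable-stable)
open import Relation.Binary.PropositionalEquality using (_≡_; _≢_; refl; sym; trans; cong; cong₂)
open +-*-Solver using (solve; _:=_; _:+_; _:*_; _:-_; con)

-- Write Q = q₀q₁.  If f|p is the literal y_j, then one of p_{y_j←0}, p_{y_j←1}
-- makes f true and the other makes it false.  Descending through f to a leaf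
-- that tells them apart shows, as in Khrapchenko's bound, that
-- Pr[f|p is a literal y_j and both p_{y_j←τ} lie in A]² ≤ Q · size f · Pr[A]².
--
-- Now simplify φ|p bottom-up.  At a gate with one input a literal of y_j and the
-- other input G, substitute the neutral value of the literal into G: if G mentions
-- y_j, this saves a leaf, which pays for the literal.  So an additional leaf is
-- only paid for when G is nonconstant and independent of y_j; G is then
-- nonconstant under both p_{y_j←0} and p_{y_j←1}, and the bound above applies
-- with A = "G is nonconstant".  Let e be the expected simplified size, literals
-- counted as 0.  Since Pr[G nonconstant] ≤ √(Q size G) + √e(G), induction on the
-- depth D gives e(f∘g) ≤ e(f) + e(g) + Q (1 + D) (size f + size g), hence
-- e(φ) ≤ Q d² s.  The remaining term t is the probability that φ|p becomes a literal.

-- Inequalities over ℚ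

interchange : ∀ a b c d → (a + b) + (c + d) ≡ (a + c) + (b + d)
interchange = solve 4 (λ a b c d → (a :+ b) :+ (c :+ d) := (a :+ c) :+ (b :+ d)) refl

+-≥0 : ∀ {x y} → 0ℚ ≤ x → 0ℚ ≤ y → 0ℚ ≤ x + y
+-≥0 = +-mono-≤

x≤x+y : ∀ x {y} → 0ℚ ≤ y → x ≤ x + y
x≤x+y x 0≤y = ≤-trans (≤-reflexive (sym (+-identityʳ x))) (+-monoʳ-≤ x 0≤y)

*-monoˡ : ∀ {x y z} → 0ℚ ≤ z → x ≤ y → z * x ≤ z * y
*-monoˡ {z = z} 0≤z = *-monoˡ-≤-nonNeg z {{nonNegative 0≤z}}

*-monoʳ : ∀ {x y z} → 0ℚ ≤ z → x ≤ y → x * z ≤ y * z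
*-monoʳ {z = z} 0≤z = *-monoʳ-≤-nonNeg z {{nonNegative 0≤z}}

*-≥0 : ∀ {x y} → 0ℚ ≤ x → 0ℚ ≤ y → 0ℚ ≤ x * y
*-≥0 {x} 0≤x 0≤y = ≤-trans (≤-reflexive (sym (*-zeroʳ x))) (*-monoˡ 0≤x 0≤y)

*-mono : ∀ {w x y z} → 0ℚ ≤ w → 0ℚ ≤ z → w ≤ x → y ≤ z → w * y ≤ x * z
*-mono 0≤w 0≤z w≤x y≤z = ≤-trans (*-monoˡ 0≤w y≤z) (*-monoʳ 0≤z w≤x)

square≥0 : ∀ x → 0ℚ ≤ x * x
square≥0 x with ≤-total 0ℚ x
... | inj₁ 0≤x = *-≥0 0≤x 0≤x
... | inj₂ x≤0 = ≤-trans (*-≥0 0≤-x 0≤-x) (≤-reflexive (solve 1 (λ x → (con 0ℚ :- x) :* (con 0ℚ :- x)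
    := x :* x) refl x))
  where
  0≤-x : 0ℚ ≤ 0ℚ - x
  0≤-x = ≤-trans (≤-reflexive (sym (+-inverseʳ x))) (+-monoˡ-≤ (- x) x≤0)

square-cancel-≤ : ∀ {x y} → 0ℚ ≤ y → x * x ≤ y * y → x ≤ y
square-cancel-≤ {x} {y} 0≤y xx≤yy with x ≤? y
... | yes x≤y = x≤y
... | no  x≰y = contradiction (<-≤-trans yy<xx xx≤yy) (<-irrefl refl)
  where
  y<x : y < x
  y<x = ≰⇒> x≰y
  yy<xx : y * y < x * x
  yy<xx = ≤-<-trans (*-monoˡ 0≤y (<⇒≤ y<x)) (*-monoˡ-<-pos x {{positive (≤-<-trans 0≤y y<x)}} y<x)

quad : ℚ → ℚ
quad z = (z + z) + (z + z)

4xy≤[x+y]² : ∀ x y → quad (x * y) ≤ (x + y) * (x + y)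
4xy≤[x+y]² x y = ≤-trans
  (x≤x+y (quad (x * y)) (square≥0 (x - y)))
  (≤-reflexive (solve 2 (λ x y → ((x :* y :+ x :* y) :+ (x :* y :+ x :* y)) :+ (x :- y) :* (x :- y)
      := (x :+ y) :* (x :+ y)) refl x y))

double-cancel-≤ : ∀ {x y} → x + x ≤ y + y → x ≤ y
double-cancel-≤ {x} {y} le with x ≤? y
... | yes x≤y = x≤y
... | no  x≰y = contradiction (<-≤-trans (+-mono-< (≰⇒> x≰y) (≰⇒> x≰y)) le) (<-irrefl refl)

-- Root-free form of √(su) + √(tv) ≤ √((s+t)(u+v)). Only the cross term needs work: its square is at
-- most 4(sv)(tu), which the AM-GM inequality bounds by (sv + tu)².
cauchy-schwarz : ∀ x y {s t u v} → 0ℚ ≤ s → 0ℚ ≤ t → 0ℚ ≤ u → 0ℚ ≤ v →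
  x * x ≤ s * u → y * y ≤ t * v → (x + y) * (x + y) ≤ (s + t) * (u + v)
cauchy-schwarz x y {s} {t} {u} {v} 0≤s 0≤t 0≤u 0≤v xx yy = begin
  (x + y) * (x + y)
    ≡⟨ solve 2 (λ x y → (x :+ y) :* (x :+ y) := x :* x :+ y :* y :+ (x :* y :+ x :* y)) refl x y ⟩
  x * x + y * y + (x * y + x * y)       ≤⟨ +-mono-≤ (+-mono-≤ xx yy) cross ⟩
  s * u + t * v + (s * v + t * u)
    ≡⟨ solve 4 (λ s t u v → s :* u :+ t :* v :+ (s :* v :+ t :* u) := (s :+ t) :* (u :+ v)) refl s t u v ⟩
  (s + t) * (u + v)                     ∎
  where
  open ≤-Reasoning
  cross : x * y + x * y ≤ s * v + t * u
  cross = square-cancel-≤ (+-≥0 (*-≥0 0≤s 0≤v) (*-≥0 0≤t 0≤u)) (begin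
    (x * y + x * y) * (x * y + x * y)
      ≡⟨ solve 2 (λ x y → (x :* y :+ x :* y) :* (x :* y :+ x :* y)
          := let z = (x :* x) :* (y :* y) in (z :+ z) :+ (z :+ z)) refl x y ⟩
    quad ((x * x) * (y * y))            ≤⟨ +-mono-≤ (+-mono-≤ p p) (+-mono-≤ p p) ⟩
    quad ((s * u) * (t * v))
      ≡⟨ cong quad (solve 4 (λ s t u v → (s :* u) :* (t :* v) := (s :* v) :* (t :* u)) refl s t u v) ⟩
    quad ((s * v) * (t * u))            ≤⟨ 4xy≤[x+y]² (s * v) (t * u) ⟩
    (s * v + t * u) * (s * v + t * u)   ∎)
    where
    p : (x * x) * (y * y) ≤ (s * u) * (t * v)
    p = *-mono (square≥0 x) (*-≥0 0≤t 0≤v) xx yy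

-- The arithmetic of one gate. `X` will be the probability of paying for a leaf, `P` that of the
-- other input being nonconstant, `l` and `r` those of it being a literal or larger. From P² ≤ Q s₂
-- (1+D)² follows X² ≤ Q² (1+D)² s₁ s₂, and 4 s₁ s₂ ≤ (s₁ + s₂)² turns the product of sizes into
-- their sum, which is why `X` appears doubled.
gate-bound : ∀ {Q D X P l r s₁ s₂} → 0ℚ ≤ Q → 0ℚ ≤ D → 0ℚ ≤ s₁ → 0ℚ ≤ s₂ → 0ℚ ≤ P →
  X * X ≤ Q * s₁ * (P * P) → P ≤ l + r → l * l ≤ Q * s₂ → r * r ≤ Q * D * D * s₂ →
  X + X ≤ Q * (s₁ + s₂) * (1ℚ + D)
gate-bound {Q} {D} {X} {P} {l} {r} {s₁} {s₂} 0≤Q 0≤D 0≤s₁ 0≤s₂ 0≤P XX P≤ ll rr =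
  square-cancel-≤ (*-≥0 (*-≥0 0≤Q (+-≥0 0≤s₁ 0≤s₂)) 0≤1+D) (begin
    (X + X) * (X + X)
      ≡⟨ solve 1 (λ X → (X :+ X) :* (X :+ X) := (X :* X :+ X :* X) :+ (X :* X :+ X :* X)) refl X ⟩
    quad (X * X)                                    ≤⟨ +-mono-≤ (+-mono-≤ p p) (+-mono-≤ p p) ⟩
    quad (K * (s₁ * s₂))
      ≡⟨ solve 3 (λ K s t → let z = K :* (s :* t) ; w = s :* t in (z :+ z) :+ (z :+ z)
          := K :* ((w :+ w) :+ (w :+ w))) refl K s₁ s₂ ⟩
    K * quad (s₁ * s₂)                              ≤⟨ *-monoˡ (square≥0 (Q * (1ℚ + D))) (4xy≤[x+y]² s₁ s₂) ⟩
    K * ((s₁ + s₂) * (s₁ + s₂))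
      ≡⟨ solve 3 (λ Q D s → ((Q :* D) :* (Q :* D)) :* (s :* s)
          := (Q :* s :* D) :* (Q :* s :* D)) refl Q (1ℚ + D) (s₁ + s₂) ⟩
    (Q * (s₁ + s₂) * (1ℚ + D)) * (Q * (s₁ + s₂) * (1ℚ + D)) ∎)
  where
  open ≤-Reasoning
  K = (Q * (1ℚ + D)) * (Q * (1ℚ + D))
  0≤1+D : 0ℚ ≤ 1ℚ + D
  0≤1+D = +-≥0 (nonNegative⁻¹ 1ℚ) 0≤D
  -- The weights 1 and `D` match l² ≤ 1 · Q s₂ and r² ≤ D · (D Q s₂), so the right side is exactly Q
  -- s₂ (1+D)².
  PP : P * P ≤ (1ℚ + D) * (Q * s₂ + D * (Q * s₂))
  PP = ≤-trans (*-mono 0≤P (≤-trans 0≤P P≤) P≤ P≤)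
    (cauchy-schwarz l r (nonNegative⁻¹ 1ℚ) 0≤D (*-≥0 0≤Q 0≤s₂) (*-≥0 0≤D (*-≥0 0≤Q 0≤s₂))
      (≤-trans ll (≤-reflexive (sym (*-identityˡ _))))
      (≤-trans rr (≤-reflexive (solve 3 (λ Q D s → Q :* D :* D :* s := D :* (D :* (Q :* s))) refl Q D s₂))))
  p : X * X ≤ K * (s₁ * s₂)
  p = begin
    X * X                                                  ≤⟨ XX ⟩
    Q * s₁ * (P * P)                                       ≤⟨ *-monoˡ (*-≥0 0≤Q 0≤s₁) PP ⟩
    Q * s₁ * ((1ℚ + D) * (Q * s₂ + D * (Q * s₂)))
      ≡⟨ solve 4 (λ Q D s t → Q :* s :* ((con 1ℚ :+ D) :* (Q :* t :+ D :* (Q :* t)))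
          := ((Q :* (con 1ℚ :+ D)) :* (Q :* (con 1ℚ :+ D))) :* (s :* t)) refl Q D s₁ s₂ ⟩
    K * (s₁ * s₂)                                          ∎

-- The normalisation inside `_/_` does not reduce on variables; on unnormalised fractions of
-- denominator 1 the claim is integer addition.
ℕtoℚ-+ : ∀ a b → ℕtoℚ (a ℕ.+ b) ≡ ℕtoℚ a + ℕtoℚ b
ℕtoℚ-+ a b = toℚᵘ-injective (begin-equality
  toℚᵘ (ℕtoℚ (a ℕ.+ b))                  ≃⟨ toℚᵘ-fromℚᵘ (ℚᵘ.mkℚᵘ (ℤ.+ (a ℕ.+ b)) 0) ⟩
  ℚᵘ.mkℚᵘ (ℤ.+ (a ℕ.+ b)) 0
    ≃⟨ ℚᵘ.*≡* (cong (ℤ._* ℤ.+ 1) (sym (cong₂ ℤ._+_ (ℤ.*-identityʳ (ℤ.+ a)) (ℤ.*-identityʳ (ℤ.+ b))))) ⟩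
  ℚᵘ.mkℚᵘ (ℤ.+ a) 0 ℚᵘ.+ ℚᵘ.mkℚᵘ (ℤ.+ b) 0
    ≃⟨ ℚᵘ.+-cong (toℚᵘ-fromℚᵘ (ℚᵘ.mkℚᵘ (ℤ.+ a) 0)) (toℚᵘ-fromℚᵘ (ℚᵘ.mkℚᵘ (ℤ.+ b) 0)) ⟨
  toℚᵘ (ℕtoℚ a) ℚᵘ.+ toℚᵘ (ℕtoℚ b)       ≃⟨ toℚᵘ-homo-+ (ℕtoℚ a) (ℕtoℚ b) ⟨
  toℚᵘ (ℕtoℚ a + ℕtoℚ b)                 ∎)
  where open ℚᵘ.≤-Reasoning

ℕtoℚ≥0 : ∀ a → 0ℚ ≤ ℕtoℚ a
ℕtoℚ≥0 a = nonNegative⁻¹ _ {{normalize-nonNeg a 1}}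

ℕtoℚ-mono : ∀ {a b} → a ℕ.≤ b → ℕtoℚ a ≤ ℕtoℚ b
ℕtoℚ-mono {a} {b} a≤b with ℕ.m≤n⇒∃[o]m+o≡n a≤b
... | c , refl = ≤-trans (x≤x+y (ℕtoℚ a) (ℕtoℚ≥0 c)) (≤-reflexive (sym (ℕtoℚ-+ a c)))

-- Probabilities and expectations

∧-true⁻ : ∀ {x y} → x ∧ y ≡ true → x ≡ true × y ≡ true
∧-true⁻ {true} {true} _ = refl , refl

∧-true⁺ : ∀ {x y} → x ≡ true → y ≡ true → x ∧ y ≡ true
∧-true⁺ refl refl = refl

true≢false : ∀ {x} → x ≡ true → x ≡ false → ⊥
true≢false {true} _ ()

bit : Bool → ℕ
bit b = if b then 1 else 0

module _ {n m : ℕ} where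

  NonNegWeights : Dist n m → Set
  NonNegWeights = All (λ e → 0ℚ ≤ proj₂ e)

  Event : Set
  Event = Projection n m → Bool

  indicator≥0 : ∀ {w} → 0ℚ ≤ w → ∀ b → 0ℚ ≤ (if b then w else 0ℚ)
  indicator≥0 0≤w true  = 0≤w
  indicator≥0 0≤w false = ≤-refl

  Pr≥0 : ∀ {d} → NonNegWeights d → ∀ E → 0ℚ ≤ Pr d E
  Pr≥0 []          E = ≤-refl
  Pr≥0 (0≤w ∷ 0≤d) E = +-≥0 (indicator≥0 0≤w (E _)) (Pr≥0 0≤d E)

  Pr-union : ∀ {d} → NonNegWeights d → ∀ {E F G : Event} →
    (∀ p → E p ≡ true → F p ≡ true ⊎ G p ≡ true) → Pr d E ≤ Pr d F + Pr d G
  Pr-union [] _ = ≤-refl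
  Pr-union {(p , w) ∷ d} (0≤w ∷ 0≤d) {E} {F} {G} cover = ≤-trans
    (+-mono-≤ (step (E p) (F p) (G p) (cover p)) (Pr-union 0≤d cover))
    (≤-reflexive (interchange (if F p then w else 0ℚ) (if G p then w else 0ℚ) (Pr d F) (Pr d G)))
    where
    step : ∀ e f g → (e ≡ true → f ≡ true ⊎ g ≡ true) →
      (if e then w else 0ℚ) ≤ (if f then w else 0ℚ) + (if g then w else 0ℚ)
    step false f g _ = +-≥0 (indicator≥0 0≤w f) (indicator≥0 0≤w g)
    step true f g c with c refl
    ... | inj₁ refl = x≤x+y w (indicator≥0 0≤w g)
    ... | inj₂ refl = ≤-trans (≤-reflexive (sym (+-identityˡ w))) (+-monoˡ-≤ w (indicator≥0 0≤w f))

  Pr-disjoint : ∀ {d} → NonNegWeights d → ∀ {E F G : Event} →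
    (∀ p → E p ≡ true → G p ≡ true) → (∀ p → F p ≡ true → G p ≡ true) →
    (∀ p → E p ≡ true → F p ≡ true → ⊥) → Pr d E + Pr d F ≤ Pr d G
  Pr-disjoint [] _ _ _ = ≤-refl
  Pr-disjoint {(p , w) ∷ d} (0≤w ∷ 0≤d) {E} {F} {G} E⇒G F⇒G disj = ≤-trans
    (≤-reflexive (interchange (if E p then w else 0ℚ) (Pr d E) (if F p then w else 0ℚ) (Pr d F)))
    (+-mono-≤ (step (E p) (F p) (G p) (E⇒G p) (F⇒G p) (disj p)) (Pr-disjoint 0≤d E⇒G F⇒G disj))
    where
    step : ∀ e f g → (e ≡ true → g ≡ true) → (f ≡ true → g ≡ true) → (e ≡ true → f ≡ true → ⊥) →
      (if e then w else 0ℚ) + (if f then w else 0ℚ) ≤ (if g then w else 0ℚ)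
    step true  true  _ _ _ dis = contradiction refl (dis refl)
    step true  false g c _ _ rewrite c refl = ≤-reflexive (+-identityʳ w)
    step false true  g _ c _ rewrite c refl = ≤-reflexive (+-identityˡ w)
    step false false g _ _ _ = indicator≥0 0≤w g

  Pr-mono : ∀ {d} → NonNegWeights d → ∀ {E F : Event} →
    (∀ p → E p ≡ true → F p ≡ true) → Pr d E ≤ Pr d F
  Pr-mono {d} 0≤d {E} E⇒F = ≤-trans
    (x≤x+y (Pr d E) (Pr≥0 0≤d (λ _ → false)))
    (Pr-disjoint 0≤d E⇒F (λ _ ()) (λ _ _ ()))

  Pr≤totalWeight : ∀ {d} → NonNegWeights d → ∀ E → Pr d E ≤ totalWeight d
  Pr≤totalWeight [] E = ≤-refl
  Pr≤totalWeight {(p , w) ∷ d} (0≤w ∷ 0≤d) E = +-mono-≤ (step (E p)) (Pr≤totalWeight 0≤d E)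
    where
    step : ∀ e → (if e then w else 0ℚ) ≤ w
    step true  = ≤-refl
    step false = 0≤w

  Exp-mono : ∀ {d} → NonNegWeights d → ∀ {g h : Projection n m → ℕ} →
    (∀ p → g p ℕ.≤ h p) → Exp d g ≤ Exp d h
  Exp-mono []          _   = ≤-refl
  Exp-mono (0≤w ∷ 0≤d) g≤h = +-mono-≤ (*-monoˡ 0≤w (ℕtoℚ-mono (g≤h _))) (Exp-mono 0≤d g≤h)

  Exp-+ : ∀ d (g h : Projection n m → ℕ) → Exp d (λ p → g p ℕ.+ h p) ≡ Exp d g + Exp d h
  Exp-+ []            g h = refl
  Exp-+ ((p , w) ∷ d) g h = trans
    (cong₂ _+_ (trans (cong (w *_) (ℕtoℚ-+ (g p) (h p))) (*-distribˡ-+ w (ℕtoℚ (g p)) (ℕtoℚ (h p)))) (Exp-+ d g h))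
    (interchange (w * ℕtoℚ (g p)) (w * ℕtoℚ (h p)) (Exp d g) (Exp d h))

  Exp-bit : ∀ d (E : Event) → Exp d (λ p → bit (E p)) ≡ Pr d E
  Exp-bit []            E = refl
  Exp-bit ((p , w) ∷ d) E = cong₂ _+_ (step (E p)) (Exp-bit d E)
    where
    step : ∀ e → w * ℕtoℚ (bit e) ≡ (if e then w else 0ℚ)
    step true  = *-identityʳ w
    step false = *-zeroʳ w

  Exp-zero : ∀ d {g : Projection n m → ℕ} → (∀ p → g p ≡ 0) → Exp d g ≡ 0ℚ
  Exp-zero []            g≡0 = refl
  Exp-zero ((p , w) ∷ d) g≡0 rewrite g≡0 p = cong₂ _+_ (*-zeroʳ w) (Exp-zero d g≡0)

-- Equality and finite enumeration of projections

eqB⇒≡ : ∀ b c → eqB b c ≡ true → b ≡ c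
eqB⇒≡ true  true  _ = refl
eqB⇒≡ false false _ = refl

eqB-refl : ∀ b → eqB b b ≡ true
eqB-refl true  = refl
eqB-refl false = refl

eqT⇒≡ : ∀ {m} (s t : Target m) → eqT s t ≡ true → s ≡ t
eqT⇒≡ (const b) (const c) e = cong const (eqB⇒≡ b c e)
eqT⇒≡ (lit j p) (lit k r) e with j ≟ k
... | yes refl = cong (lit j) (eqB⇒≡ p r e)

eqT-refl : ∀ {m} (t : Target m) → eqT t t ≡ true
eqT-refl (const b) = eqB-refl b
eqT-refl (lit j p) with j ≟ j
... | yes _  = eqB-refl p
... | no j≢j = contradiction refl j≢j

eqP⇒≡ : ∀ {n m} (π ρ : Projection n m) → eqP π ρ ≡ true → π ≡ ρ
eqP⇒≡ []      []      _ = refl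
eqP⇒≡ (s ∷ π) (t ∷ ρ) e with ∧-true⁻ e
... | e₁ , e₂ = cong₂ _∷_ (eqT⇒≡ s t e₁) (eqP⇒≡ π ρ e₂)

eqP-refl : ∀ {n m} (π : Projection n m) → eqP π π ≡ true
eqP-refl []      = refl
eqP-refl (t ∷ π) = ∧-true⁺ (eqT-refl t) (eqP-refl π)

bools : List Bool
bools = true ∷ false ∷ []

∈-bools : ∀ b → b ∈ bools
∈-bools true  = here refl
∈-bools false = there (here refl)

targets : ∀ m → List (Target m)
targets m = const true ∷ const false ∷ cartesianProductWith lit (allFin m) bools

∈-targets : ∀ {m} (t : Target m) → t ∈ targets m
∈-targets (const true)  = here refl
∈-targets (const false) = there (here refl)
∈-targets (lit j p)     = there (there (∈-cartesianProductWith⁺ lit (∈-allFin j) (∈-bools p)))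

projections : ∀ n m → List (Projection n m)
projections zero    m = [] ∷ []
projections (suc n) m = cartesianProductWith _∷_ (targets m) (projections n m)

∈-projections : ∀ {n m} (π : Projection n m) → π ∈ projections n m
∈-projections []      = here refl
∈-projections (t ∷ π) = ∈-cartesianProductWith⁺ _∷_ (∈-targets t) (∈-projections π)

member : ∀ {n m} → List (Projection n m) → Projection n m → Bool
member []      p = false
member (π ∷ L) p = eqP π p ∨ member L p

∈⇒member : ∀ {n m} {L : List (Projection n m)} {p} → p ∈ L → member L p ≡ true
∈⇒member {p = p} (here refl) rewrite eqP-refl p = refl
∈⇒member {L = π ∷ L} {p} (there p∈L) with eqP π p
... | true  = refl
... | false = ∈⇒member p∈L

-- Events about fixing one variable

-- `fixEvent` with the single target projection replaced by a whole event `X`.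
fixInto : ∀ {n m} → Fin n → Bool → (Projection n m → Bool) → Projection n m → Bool
fixInto i σ X p with lookup p i
... | const _ = false
... | lit j _ = X (subst p j σ)

-- Evaluating at one assignment labels every projection with a bit, even where `f` does not become
-- constant. Where it does, the bit is that constant.
at0 : ∀ {n m} → Formula n → Projection n m → Bool
at0 f π = restrict f π (λ _ → false)

-- Substituting for y_j changes only targets that are literals of y_j, so a leaf that tells two such
-- substitutions apart must be sent to one.
separated⇒lit : ∀ {m} r (t : Target m) j {σ τ} a →
  litVal r (applyT (substT j σ t) a) ≡ true → litVal r (applyT (substT j τ t) a) ≡ false →
  Σ Bool λ s → t ≡ lit j s
separated⇒lit r (const b) j a e₁ e₀ = contradiction e₀ (true≢false e₁)
separated⇒lit r (lit k s) j a e₁ e₀ with k ≟ j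
... | yes refl = s , refl
... | no  _    = contradiction e₀ (true≢false e₁)

-- In Khrapchenko's picture `p` is an edge joining its two fixings, and this event says that the
-- edge runs from `U` to `V`. The variable comes from a separate `J`, so that it stays the same
-- while the induction descends to subformulas.
bothFix : ∀ {n m} → (Projection n m → Maybe (Fin m)) → Bool →
  (U V : Projection n m → Bool) → Projection n m → Bool
bothFix J σ U V p with J p
... | nothing = false
... | just j  = U (subst p j σ) ∧ V (subst p j (not σ))

bothFix-cover : ∀ {n m} (J : Projection n m → Maybe (Fin m)) σ {U V U₁ V₁ U₂ V₂} →
  (∀ π ρ → U π ≡ true → V ρ ≡ true → (U₁ π ≡ true × V₁ ρ ≡ true) ⊎ (U₂ π ≡ true × V₂ ρ ≡ true)) →
  ∀ p → bothFix J σ U V p ≡ true → bothFix J σ U₁ V₁ p ≡ true ⊎ bothFix J σ U₂ V₂ p ≡ true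
bothFix-cover J σ cover p e with J p
... | just j with ∧-true⁻ e
... | u , v with cover _ _ u v
... | inj₁ (u₁ , v₁) = inj₁ (∧-true⁺ u₁ v₁)
... | inj₂ (u₂ , v₂) = inj₂ (∧-true⁺ u₂ v₂)

-- Simplifying a formula under a projection

-- Assignments are functions and function extensionality is not assumed; this is what allows an
-- assignment to be replaced by its tabulated copy in `constant?`.
Extensional : ∀ {m} → BoolFun m → Set
Extensional f = ∀ {a b} → (∀ k → a k ≡ b k) → f a ≡ f b

eval-ext : ∀ {n} (φ : Formula n) → Extensional (eval φ)
eval-ext (leaf i p) a≗b = cong (litVal p) (a≗b i)
eval-ext (and φ ψ)  a≗b = cong₂ _∧_ (eval-ext φ a≗b) (eval-ext ψ a≗b)
eval-ext (or φ ψ)   a≗b = cong₂ _∨_ (eval-ext φ a≗b) (eval-ext ψ a≗b)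

applyT-ext : ∀ {m} (t : Target m) → Extensional (applyT t)
applyT-ext (const b) a≗b = refl
applyT-ext (lit j p) a≗b = cong (litVal p) (a≗b j)

restrict-ext : ∀ {n m} (φ : Formula n) (π : Projection n m) → Extensional (restrict φ π)
restrict-ext φ π a≗b = eval-ext φ (λ i → applyT-ext (lookup π i) a≗b)

-- A subset is a vector of Booleans, hence an assignment: the search looks for one whose value
-- differs from that at the all-false assignment.
constant? : ∀ {m} (f : BoolFun m) → Extensional f → Dec (Constant f)
constant? f ext with anySubset? (λ v → ¬? (f (lookup v) Bool.≟ f (λ _ → false)))
... | yes (v , differ) = no λ (b , f≡b) → differ (trans (f≡b _) (sym (f≡b _)))
... | no  none         = yes (f (λ _ → false) , λ a →
  trans (ext (λ k → sym (lookup∘tabulate a k)))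
        (decidable-stable (_ Bool.≟ _) (λ differ → none (tabulate a , differ))))

update : ∀ {m} → (Fin m → Bool) → Fin m → Bool → Fin m → Bool
update a j σ k = if does (k ≟ j) then σ else a k

update-same : ∀ {m} (a : Fin m → Bool) j σ → update a j σ j ≡ σ
update-same a j σ with j ≟ j
... | yes _  = refl
... | no j≢j = contradiction refl j≢j

update-other : ∀ {m} (a : Fin m → Bool) j σ k → k ≢ j → update a j σ k ≡ a k
update-other a j σ k k≢j with k ≟ j
... | yes k≡j = contradiction k≡j k≢j
... | no  _   = refl

restrict-subst : ∀ {n m} (φ : Formula n) (π : Projection n m) j σ a →
  restrict φ (subst π j σ) a ≡ restrict φ π (update a j σ)
restrict-subst φ π j σ a = eval-ext φ λ i →
  trans (cong (λ t → applyT t a) (lookup-map i (substT j σ) π)) (target (lookup π i))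
  where
  target : ∀ t → applyT (substT j σ t) a ≡ applyT t (update a j σ)
  target (const b) = refl
  target (lit k p) with k ≟ j
  ... | yes _ = refl
  ... | no  _ = refl

litVal-involutive : ∀ p b → litVal p (litVal p b) ≡ b
litVal-involutive true  b = refl
litVal-involutive false b = Bool.not-involutive b

-- Both gates at once: `gate b` is the one for which b is the neutral value.
op : Bool → Bool → Bool → Bool
op true  = _∧_
op false = _∨_

gate : ∀ {m} → Bool → Formula m → Formula m → Formula m
gate true  = and
gate false = or

eval-gate : ∀ {m} b (φ ψ : Formula m) a → eval (gate b φ ψ) a ≡ op b (eval φ a) (eval ψ a)
eval-gate true  φ ψ a = refl
eval-gate false φ ψ a = refl

size-gate : ∀ {m} b (φ ψ : Formula m) → size (gate b φ ψ) ≡ size φ ℕ.+ size ψ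
size-gate true  φ ψ = refl
size-gate false φ ψ = refl

op-comm : ∀ b x y → op b x y ≡ op b y x
op-comm true  = Bool.∧-comm
op-comm false = Bool.∨-comm

op-neutralˡ : ∀ b y → op b b y ≡ y
op-neutralˡ true  y = refl
op-neutralˡ false y = refl

op-neutralʳ : ∀ b x → op b x b ≡ x
op-neutralʳ b x = trans (op-comm b x b) (op-neutralˡ b x)

op-absorbˡ : ∀ b y → op b (not b) y ≡ not b
op-absorbˡ true  y = refl
op-absorbˡ false y = refl

op-absorbʳ : ∀ b x → op b x (not b) ≡ not b
op-absorbʳ b x = trans (op-comm b x (not b)) (op-absorbˡ b x)

bool-cases : ∀ b c → c ≡ b ⊎ c ≡ not b
bool-cases true  true  = inj₁ refl
bool-cases true  false = inj₂ refl
bool-cases false true  = inj₂ refl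
bool-cases false false = inj₁ refl

size≥1 : ∀ {n} (φ : Formula n) → 1 ℕ.≤ size φ
size≥1 (leaf _ _) = s≤s z≤n
size≥1 (and φ ψ)  = ℕ.≤-trans (size≥1 φ) (ℕ.m≤m+n (size φ) (size ψ))
size≥1 (or φ ψ)   = ℕ.≤-trans (size≥1 φ) (ℕ.m≤m+n (size φ) (size ψ))

-- Substituting a value for one variable of a formula

-- The outcomes of setting y_j to `σ` in `G`: y_j does not occur, the result is constant, or a leaf
-- is saved. The last two are stated as agreement on assignments with `a j ≡ σ`, so the original
-- variables are kept.
data Plug {m} (j : Fin m) (σ : Bool) (G : Formula m) : Set where
  fresh   : (∀ a b → (∀ k → k ≢ j → a k ≡ b k) → eval G a ≡ eval G b) → Plug j σ G
  fixed   : ∀ c → (∀ a → a j ≡ σ → eval G a ≡ c) → Plug j σ G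
  smaller : ∀ G′ → (∀ a → a j ≡ σ → eval G a ≡ eval G′ a) → size G′ ℕ.< size G → Plug j σ G

-- An input fixed to the neutral value disappears, saving its leaves; one fixed to the other value
-- fixes the gate. Otherwise a saving in either input is a saving in the gate.
plugGate : ∀ {m} b {j : Fin m} {σ G H} → Plug j σ G → Plug j σ H → Plug j σ (gate b G H)
plugGate b {G = G} {H} (fixed c eq) H/ with bool-cases b c
... | inj₁ refl = smaller H
  (λ a e → trans (eval-gate b G H a) (trans (cong (λ x → op b x (eval H a)) (eq a e)) (op-neutralˡ b _)))
  (ℕ.≤-trans (ℕ.+-monoˡ-≤ (size H) (size≥1 G)) (ℕ.≤-reflexive (sym (size-gate b G H))))
... | inj₂ refl = fixed (not b)
  (λ a e → trans (eval-gate b G H a) (trans (cong (λ x → op b x (eval H a)) (eq a e)) (op-absorbˡ b _)))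
plugGate b {G = G} {H} G/ (fixed c eq) with bool-cases b c
... | inj₁ refl = smaller G
  (λ a e → trans (eval-gate b G H a) (trans (cong (op b (eval G a)) (eq a e)) (op-neutralʳ b _)))
  (ℕ.≤-trans (ℕ.≤-reflexive (ℕ.+-comm 1 (size G))) (ℕ.≤-trans (ℕ.+-monoʳ-≤ (size G) (size≥1 H)) (ℕ.≤-reflexive (sym (size-gate b G H)))))
... | inj₂ refl = fixed (not b)
  (λ a e → trans (eval-gate b G H a) (trans (cong (op b (eval G a)) (eq a e)) (op-absorbʳ b _)))
plugGate b {G = G} {H} (fresh eqG) (fresh eqH) = fresh λ a a′ e →
  trans (eval-gate b G H a) (trans (cong₂ (op b) (eqG a a′ e) (eqH a a′ e)) (sym (eval-gate b G H a′)))
plugGate b {G = G} {H} (fresh _) (smaller H′ eq H′<H) = smaller (gate b G H′)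
  (λ a e → trans (eval-gate b G H a) (trans (cong (op b (eval G a)) (eq a e)) (sym (eval-gate b G H′ a))))
  (gate-< (ℕ.+-monoʳ-< (size G) H′<H))
  where
  gate-< : size G ℕ.+ size H′ ℕ.< size G ℕ.+ size H → size (gate b G H′) ℕ.< size (gate b G H)
  gate-< lt rewrite size-gate b G H′ | size-gate b G H = lt
plugGate b {G = G} {H} (smaller G′ eq G′<G) (fresh _) = smaller (gate b G′ H)
  (λ a e → trans (eval-gate b G H a) (trans (cong (λ x → op b x (eval H a)) (eq a e)) (sym (eval-gate b G′ H a))))
  (gate-< (ℕ.+-monoˡ-< (size H) G′<G))
  where
  gate-< : size G′ ℕ.+ size H ℕ.< size G ℕ.+ size H → size (gate b G′ H) ℕ.< size (gate b G H)
  gate-< lt rewrite size-gate b G′ H | size-gate b G H = lt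
plugGate b {G = G} {H} (smaller G′ eqG G′<G) (smaller H′ eqH H′<H) = smaller (gate b G′ H′)
  (λ a e → trans (eval-gate b G H a) (trans (cong₂ (op b) (eqG a e) (eqH a e)) (sym (eval-gate b G′ H′ a))))
  (gate-< (ℕ.+-mono-< G′<G H′<H))
  where
  gate-< : size G′ ℕ.+ size H′ ℕ.< size G ℕ.+ size H → size (gate b G′ H′) ℕ.< size (gate b G H)
  gate-< lt rewrite size-gate b G′ H′ | size-gate b G H = lt

plug : ∀ {m} (G : Formula m) j σ → Plug j σ G
plug (leaf k p) j σ with k ≟ j
... | yes refl = fixed (litVal p σ) (λ a e → cong (litVal p) e)
... | no  k≢j  = fresh (λ a b a≗b → cong (litVal p) (a≗b k k≢j))
plug (and G H) j σ = plugGate true (plug G j σ) (plug H j σ)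
plug (or G H)  j σ = plugGate false (plug G j σ) (plug H j σ)

-- Simplified forms and the cost of a gate

data Simp {m} (f : BoolFun m) : Set where
  triv : Constant f → Simp f
  form : ¬ Constant f → ∀ ψ → Computes ψ f → Simp f

-- Single literals are free here; they are charged separately, once, at the end.
big : ∀ {m} → Formula m → ℕ
big (leaf _ _) = 0
big φ          = size φ

weight : ∀ {m} {f : BoolFun m} → Simp f → ℕ
weight (triv _)     = 0
weight (form _ ψ _) = big ψ

isFresh : ∀ {m} {j : Fin m} {σ G} → Plug j σ G → Bool
isFresh (fresh _) = true
isFresh _         = false

-- Since `litVal p` is an involution, `litVal p b` is the value of y_j at which the literal takes
-- the neutral value `b`.
freshLeaf : ∀ {m} → Bool → Formula m → Formula m → Bool
freshLeaf b (leaf j p) G = isFresh (plug G j (litVal p b))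
freshLeaf b _          G = false

badPair : ∀ {m} {f g : BoolFun m} → Bool → Simp f → Simp g → Bool
badPair b (form _ F _) (form _ G _) = freshLeaf b F G
badPair b _            _            = false

leaf-or-big : ∀ {m} (φ : Formula m) → (Σ (Fin m) λ j → Σ Bool λ p → φ ≡ leaf j p) ⊎ big φ ≡ size φ
leaf-or-big (leaf j p) = inj₁ (j , p , refl)
leaf-or-big (and _ _)  = inj₂ refl
leaf-or-big (or _ _)   = inj₂ refl

big-gate : ∀ {m} b (φ ψ : Formula m) → big (gate b φ ψ) ≡ size φ ℕ.+ size ψ
big-gate true  φ ψ = refl
big-gate false φ ψ = refl

-- Where y_j ≠ litVal p b the literal already decides the gate, so only G at y_j = litVal p b matters.
op-literal-cong : ∀ {m} b (a : Fin m → Bool) j p {x y} → (a j ≡ litVal p b → x ≡ y) →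
  op b (litVal p (a j)) x ≡ op b (litVal p (a j)) y
op-literal-cong b a j p {x} {y} eq with bool-cases b (litVal p (a j))
... | inj₁ e = cong (op b (litVal p (a j))) (eq (trans (sym (litVal-involutive p (a j))) (cong (litVal p) e)))
... | inj₂ e rewrite e = trans (op-absorbˡ b x) (sym (op-absorbˡ b y))

-- Both directions are charged so that the expression agrees with the bound in `combine`, where
-- either input may be the literal.
attachCost : ∀ {m} → Bool → Fin m → Bool → Formula m → ℕ
attachCost b j p G = big G ℕ.+ (bit (freshLeaf b (leaf j p) G) ℕ.+ bit (freshLeaf b G (leaf j p)))

-- If the constant is neutral, only the literal remains; if it is absorbing, the gate would be
-- constant, which `h` is not.
attachFixed : ∀ {m} b j p (G : Formula m) {h : BoolFun m} → ¬ Constant h →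
  (∀ a → h a ≡ op b (litVal p (a j)) (eval G a)) →
  ∀ c → (∀ a → a j ≡ litVal p b → eval G a ≡ c) → Computes (leaf j p) h
attachFixed b j p G nonconst h≡ c eq with bool-cases b c
... | inj₁ refl = λ a → sym (trans (h≡ a) (trans (op-literal-cong b a j p (eq a)) (op-neutralʳ b _)))
... | inj₂ refl = contradiction
  (not b , λ a → trans (h≡ a) (trans (op-literal-cong b a j p (eq a)) (op-absorbʳ b _))) nonconst

attachGate : ∀ {m} b j p (G : Formula m) {h : BoolFun m} →
  (∀ a → h a ≡ op b (litVal p (a j)) (eval G a)) → Computes (gate b (leaf j p) G) h
attachGate b j p G h≡ a = trans (eval-gate b (leaf j p) G a) (sym (h≡ a))

-- Substituting the neutral value into `G` either leaves the literal alone, or saves a leaf that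
-- pays for the literal, or finds y_j absent from `G`; only in the last case is a leaf charged.
attach : ∀ {m} b j p (G : Formula m) {h : BoolFun m} → ¬ Constant h →
  (∀ a → h a ≡ op b (litVal p (a j)) (eval G a)) →
  Σ (Formula m) λ ψ → Computes ψ h × big ψ ℕ.≤ attachCost b j p G
attach b j p G nonconst h≡ with leaf-or-big G
-- The two terms of `attachCost` compare the variables in opposite orders, so both comparisons must
-- be resolved.
attach b j p G nonconst h≡ | inj₁ (k , r , refl) with k ≟ j | j ≟ k
... | yes refl | _ = leaf j p
                   , attachFixed b j p (leaf j r) nonconst h≡ (litVal r (litVal p b)) (λ a e → cong (litVal r) e) , z≤n
... | no k≢j | yes j≡k = contradiction (sym j≡k) k≢j
-- Neither literal mentions the other's variable, so both terms are 1 and together pay for the two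
-- leaves, which counted 0 before.
... | no _   | no _    = gate b (leaf j p) (leaf k r) , attachGate b j p (leaf k r) h≡
                       , ℕ.≤-reflexive (big-gate b (leaf j p) (leaf k r))
attach b j p G nonconst h≡ | inj₂ big≡size with plug G j (litVal p b)
... | fixed c eq = leaf j p , attachFixed b j p G nonconst h≡ c eq , z≤n
... | fresh _ = gate b (leaf j p) G , attachGate b j p G h≡ , (begin
    big (gate b (leaf j p) G)   ≡⟨ big-gate b (leaf j p) G ⟩
    1 ℕ.+ size G                  ≡⟨ ℕ.+-comm 1 (size G) ⟩
    size G ℕ.+ 1                  ≡⟨ cong (ℕ._+ 1) big≡size ⟨
    big G ℕ.+ 1                   ≤⟨ ℕ.+-monoʳ-≤ (big G) (s≤s z≤n) ⟩
    big G ℕ.+ (1 ℕ.+ bit (freshLeaf b G (leaf j p))) ∎)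
    where open ℕ.≤-Reasoning
... | smaller G′ eq G′<G = gate b (leaf j p) G′
    , attachGate b j p G′ (λ a → trans (h≡ a) (op-literal-cong b a j p (eq a))) , (begin
    big (gate b (leaf j p) G′)  ≡⟨ big-gate b (leaf j p) G′ ⟩
    1 ℕ.+ size G′                 ≤⟨ G′<G ⟩
    size G                      ≡⟨ big≡size ⟨
    big G                       ≤⟨ ℕ.m≤m+n (big G) _ ⟩
    big G ℕ.+ (0 ℕ.+ bit (freshLeaf b G (leaf j p))) ∎)
    where open ℕ.≤-Reasoning

-- A constant input drops out or decides the gate, a literal is handled by `attach`, and two larger
-- inputs are joined as they are, their weights being their sizes.
combine : ∀ {m} b {f g h : BoolFun m} → Extensional h → (∀ a → h a ≡ op b (f a) (g a)) →
  (r : Simp f) (s : Simp g) →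
  Σ (Simp h) λ t → weight t ℕ.≤ (weight r ℕ.+ weight s) ℕ.+ (bit (badPair b r s) ℕ.+ bit (badPair b s r))
combine b {f} {g} {h} ext h≡ r s with constant? h ext
-- Deciding constancy first provides the evidence that `form` stores and rules out inputs that
-- absorb the gate.
... | yes const-h = triv const-h , z≤n
... | no  nonconst = go r s
  where
  go : (r : Simp f) (s : Simp g) →
    Σ (Simp h) λ t → weight t ℕ.≤ (weight r ℕ.+ weight s) ℕ.+ (bit (badPair b r s) ℕ.+ bit (badPair b s r))
  go (triv (c , f≡c)) (triv (c′ , g≡c′)) =
    contradiction (op b c c′ , λ a → trans (h≡ a) (cong₂ (op b) (f≡c a) (g≡c′ a))) nonconst
  go (triv (c , f≡c)) (form _ G G≡) with bool-cases b c
  ... | inj₁ refl = form nonconst G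
    (λ a → trans (G≡ a) (sym (trans (h≡ a) (trans (cong (λ x → op b x (g a)) (f≡c a)) (op-neutralˡ b _))))) , ℕ.m≤m+n (big G) 0
  ... | inj₂ refl = contradiction
    (not b , λ a → trans (h≡ a) (trans (cong (λ x → op b x (g a)) (f≡c a)) (op-absorbˡ b _))) nonconst
  go (form _ F F≡) (triv (c , g≡c)) with bool-cases b c
  ... | inj₁ refl = form nonconst F
    (λ a → trans (F≡ a) (sym (trans (h≡ a) (trans (cong (op b (f a)) (g≡c a)) (op-neutralʳ b _)))))
    , ℕ.≤-trans (ℕ.m≤m+n (big F) 0) (ℕ.m≤m+n (big F ℕ.+ 0) 0)
  ... | inj₂ refl = contradiction
    (not b , λ a → trans (h≡ a) (trans (cong (op b (f a)) (g≡c a)) (op-absorbʳ b _))) nonconst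
  go (form _ F F≡) (form _ G G≡) with leaf-or-big F | leaf-or-big G
  ... | inj₁ (j , p , refl) | _
    with attach b j p G nonconst (λ a → trans (h≡ a) (cong₂ (op b) (sym (F≡ a)) (sym (G≡ a))))
  ...   | ψ , ψ≡ , ψ≤ = form nonconst ψ ψ≡ , ψ≤
  go (form _ F F≡) (form _ G G≡) | inj₂ _ | inj₁ (k , r , refl)
    with attach b k r F nonconst (λ a → trans (h≡ a) (trans (cong₂ (op b) (sym (F≡ a)) (sym (G≡ a))) (op-comm b _ _)))
  ...   | ψ , ψ≡ , ψ≤ = form nonconst ψ ψ≡ , (begin
    big ψ                                                                                ≤⟨ ψ≤ ⟩
    big F ℕ.+ (bit (freshLeaf b (leaf k r) F) ℕ.+ bit (freshLeaf b F (leaf k r)))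
      ≡⟨ cong₂ ℕ._+_ (sym (ℕ.+-identityʳ (big F))) (ℕ.+-comm (bit (freshLeaf b (leaf k r) F)) _) ⟩
    (big F ℕ.+ 0) ℕ.+ (bit (freshLeaf b F (leaf k r)) ℕ.+ bit (freshLeaf b (leaf k r) F))      ∎)
    where open ℕ.≤-Reasoning
  go (form _ F F≡) (form _ G G≡) | inj₂ bigF | inj₂ bigG = form nonconst (gate b F G)
    (λ a → trans (eval-gate b F G a) (trans (cong₂ (op b) (F≡ a) (G≡ a)) (sym (h≡ a))))
    , ℕ.≤-trans (ℕ.≤-reflexive (trans (big-gate b F G) (cong₂ ℕ._+_ (sym bigF) (sym bigG)))) (ℕ.m≤m+n (big F ℕ.+ big G) _)

literal-nonconstant : ∀ {m} (j : Fin m) p → ¬ Constant (λ a → litVal p (a j))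
literal-nonconstant j true  (b , e) = true≢false (sym (e (λ _ → true))) (sym (e (λ _ → false)))
literal-nonconstant j false (b , e) = true≢false (sym (e (λ _ → false))) (sym (e (λ _ → true)))

litVal-∘ : ∀ r s b → litVal (litVal r s) b ≡ litVal r (litVal s b)
litVal-∘ true  s     b = refl
litVal-∘ false true  b = refl
litVal-∘ false false b = sym (Bool.not-involutive b)

simpTarget : ∀ {m} r (t : Target m) → Simp (λ a → litVal r (applyT t a))
simpTarget r (const b) = triv (litVal r b , λ _ → refl)
simpTarget r (lit j s) = form
  (λ (b , e) → literal-nonconstant j (litVal r s) (b , λ a → trans (litVal-∘ r s (a j)) (e a)))
  (leaf j (litVal r s)) (λ a → litVal-∘ r s (a j))

simp : ∀ {n m} (φ : Formula n) (π : Projection n m) → Simp (restrict φ π)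
simp (leaf i r) π = simpTarget r (lookup π i)
simp (and f g)  π = proj₁ (combine true  (restrict-ext (and f g) π) (λ _ → refl) (simp f π) (simp g π))
simp (or f g)   π = proj₁ (combine false (restrict-ext (or f g) π)  (λ _ → refl) (simp f π) (simp g π))

-- What a simplified form reveals about the function

literalVar : ∀ {m} {f : BoolFun m} → Simp f → Maybe (Fin m)
literalVar (form _ (leaf j _) _) = just j
literalVar _                     = nothing

isLiteral isBig isNonconstant : ∀ {m} {f : BoolFun m} → Simp f → Bool
isLiteral (form _ (leaf _ _) _) = true
isLiteral _                     = false
isBig (form _ (leaf _ _) _)     = false
isBig (form _ _ _)              = true
isBig (triv _)                  = false
isNonconstant (triv _)          = false
isNonconstant (form _ _ _)      = true

nonconstant⇒literal⊎big : ∀ {m} {f : BoolFun m} (s : Simp f) →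
  isNonconstant s ≡ true → isLiteral s ≡ true ⊎ isBig s ≡ true
nonconstant⇒literal⊎big (form _ (leaf _ _) _) _ = inj₁ refl
nonconstant⇒literal⊎big (form _ (and _ _) _)  _ = inj₂ refl
nonconstant⇒literal⊎big (form _ (or _ _) _)   _ = inj₂ refl

¬Constant⇒isNonconstant : ∀ {m} {f : BoolFun m} (s : Simp f) → ¬ Constant f → isNonconstant s ≡ true
¬Constant⇒isNonconstant (triv c)     nonconst = contradiction c nonconst
¬Constant⇒isNonconstant (form _ _ _) _        = refl

isBig≤weight : ∀ {m} {f : BoolFun m} (s : Simp f) → bit (isBig s) ℕ.≤ weight s
isBig≤weight (triv _)              = z≤n
isBig≤weight (form _ (leaf _ _) _) = z≤n
isBig≤weight (form _ (and φ ψ) _)  = size≥1 (and φ ψ)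
isBig≤weight (form _ (or φ ψ) _)   = size≥1 (or φ ψ)

-- The bit restores the single leaf that `weight` does not count.
IsL≤ : ∀ {m} {f : BoolFun m} {k} → IsL f k → (s : Simp f) → k ℕ.≤ weight s ℕ.+ bit (isLiteral s)
IsL≤ (inj₁ (_ , refl))         s            = z≤n
IsL≤ (inj₂ (nonconst , _))     (triv c)     = contradiction c nonconst
IsL≤ (inj₂ (_ , _ , minimal))  (form _ ψ@(leaf _ _) e) = minimal ψ e
IsL≤ (inj₂ (_ , _ , minimal))  (form _ ψ@(and _ _) e)  = ℕ.≤-trans (minimal ψ e) (ℕ.m≤m+n (size ψ) 0)
IsL≤ (inj₂ (_ , _ , minimal))  (form _ ψ@(or _ _) e)   = ℕ.≤-trans (minimal ψ e) (ℕ.m≤m+n (size ψ) 0)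

IndependentOf : ∀ {m} → Fin m → BoolFun m → Set
IndependentOf j g = ∀ a b → (∀ k → k ≢ j → a k ≡ b k) → g a ≡ g b

isLiteral-sound : ∀ {m} {f : BoolFun m} (s : Simp f) → isLiteral s ≡ true →
  Σ (Fin m) λ j → Σ Bool λ r → (∀ a → f a ≡ litVal r (a j)) × literalVar s ≡ just j
isLiteral-sound (form _ (leaf j r) e) _ = j , r , (λ a → sym (e a)) , refl

-- A leaf is charged only in this situation; the last two facts keep `g` nonconstant under both
-- values of the literal's variable.
badPair-sound : ∀ {m} b {f g : BoolFun m} (s : Simp f) (t : Simp g) → badPair b s t ≡ true →
  isLiteral s ≡ true × ¬ Constant g × (∀ {j} → literalVar s ≡ just j → IndependentOf j g)
badPair-sound b (form _ (leaf j r) _) (form nonconst G G≡) e with plug G j (litVal r b)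
... | fresh indep = refl , nonconst , λ { refl a a′ a≗a′ → trans (sym (G≡ a)) (trans (indep a a′ a≗a′) (G≡ a′)) }

-- The value at `a` equals that at `update a j τ`, which is already a value of the substituted
-- function.
independent-subst : ∀ {n m} (g : Formula n) (p : Projection n m) {j} → IndependentOf j (restrict g p) →
  ∀ τ → Constant (restrict g (subst p j τ)) → Constant (restrict g p)
independent-subst g p {j} indep τ (c , e) = c , λ a →
  trans (indep a (update a j τ) (λ k k≢j → sym (update-other a j τ k k≢j)))
        (trans (sym (restrict-subst g p j τ a)) (e a))

weight-leaf : ∀ {n m} i r (π : Projection n m) → weight (simp (leaf i r) π) ≡ 0
weight-leaf i r π with lookup π i
... | const _ = refl
... | lit _ _ = refl

-- Fixing projections

module _ {n m : ℕ} {d : Dist n m} (0≤d : NonNegWeights d) {q0 q1 : ℚ}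
         (0≤q0 : 0ℚ ≤ q0) (0≤q1 : 0ℚ ≤ q1) (fixing : Fixing q0 q1 d) where

  qσ≥0 : ∀ σ → 0ℚ ≤ qσ q0 q1 σ
  qσ≥0 false = 0≤q0
  qσ≥0 true  = 0≤q1

  fixInto-⊆ : ∀ i σ {X Y : Event {n} {m}} → (∀ π → X π ≡ true → Y π ≡ true) →
    ∀ p → fixInto i σ X p ≡ true → fixInto i σ Y p ≡ true
  fixInto-⊆ i σ X⊆Y p e with lookup p i
  ... | lit j _ = X⊆Y _ e

  FixBound : Fin n → Bool → Event {n} {m} → Set
  FixBound i σ X = Pr d (fixInto i σ X) ≤ qσ q0 q1 σ * Pr d X

  fixBound-empty : ∀ i σ (X : Event) → (∀ π → X π ≡ false) → FixBound i σ X
  fixBound-empty i σ X X≡∅ =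
    ≤-trans (≤-reflexive (none d)) (*-≥0 (qσ≥0 σ) (Pr≥0 0≤d X))
    where
    fixInto≡false : ∀ p → fixInto i σ X p ≡ false
    fixInto≡false p with lookup p i
    ... | const _ = refl
    ... | lit j _ = X≡∅ _
    none : ∀ (d : Dist n m) → Pr d (fixInto i σ X) ≡ 0ℚ
    none []            = refl
    none ((p , _) ∷ d) rewrite fixInto≡false p = trans (+-identityˡ _) (none d)

  fixBound-cong : ∀ {i σ} {X Y : Event} → (∀ π → Y π ≡ true → X π ≡ true) → (∀ π → X π ≡ true → Y π ≡ true) →
    FixBound i σ X → FixBound i σ Y
  fixBound-cong {i} {σ} Y⊆X X⊆Y bound = ≤-trans (Pr-mono 0≤d (fixInto-⊆ i σ Y⊆X))
    (≤-trans bound (*-monoˡ (qσ≥0 σ) (Pr-mono 0≤d X⊆Y)))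

  -- The union bound adds the left sides; as `π` lies outside `X`, the right sides add up without
  -- double counting.
  fixBound-insert : ∀ {i σ} (X Y : Event) π → X π ≡ false → Y π ≡ true →
    (∀ ρ → X ρ ≡ true → Y ρ ≡ true) → (∀ ρ → Y ρ ≡ true → ρ ≡ π ⊎ X ρ ≡ true) →
    FixBound i σ X → FixBound i σ Y
  fixBound-insert {i} {σ} X Y π π∉X π∈Y X⊆Y Y⊆ bound = begin
    Pr d (fixInto i σ Y)                            ≤⟨ Pr-union 0≤d cover ⟩
    Pr d (fixEvent i σ π) + Pr d (fixInto i σ X)    ≤⟨ +-mono-≤ (fixing π σ i) bound ⟩
    q * Pr d (eqP π) + q * Pr d X                   ≡⟨ *-distribˡ-+ q (Pr d (eqP π)) (Pr d X) ⟨
    q * (Pr d (eqP π) + Pr d X)                     ≤⟨ *-monoˡ (qσ≥0 σ) (Pr-disjoint 0≤d eq⇒ X⊆Y disjoint) ⟩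
    q * Pr d Y                                      ∎
    where
    open ≤-Reasoning
    q = qσ q0 q1 σ
    cover : ∀ p → fixInto i σ Y p ≡ true → fixEvent i σ π p ≡ true ⊎ fixInto i σ X p ≡ true
    cover p e with lookup p i
    ... | lit j _ with Y⊆ _ e
    ... | inj₁ refl = inj₁ (eqP-refl (subst p j σ))
    ... | inj₂ x    = inj₂ x
    eq⇒ : ∀ p → eqP π p ≡ true → Y p ≡ true
    eq⇒ p e with eqP⇒≡ π p e
    ... | refl = π∈Y
    disjoint : ∀ p → eqP π p ≡ true → X p ≡ true → ⊥
    disjoint p e x with eqP⇒≡ π p e
    ... | refl = true≢false x π∉X

  fixBound-member : ∀ i σ (X : Event) L → FixBound i σ (λ π → X π ∧ member L π)
  fixBound-member i σ X []      = fixBound-empty i σ _ (λ π → Bool.∧-zeroʳ (X π))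
  -- `π` enlarges the event only if it lies in `X` and is not listed again in `L`; otherwise the
  -- event stays the same.
  fixBound-member i σ X (π ∷ L) = insert (X π ∧ not (member L π)) refl
    where
    XL XπL : Event
    XL  ρ = X ρ ∧ member L ρ
    XπL ρ = X ρ ∧ member (π ∷ L) ρ
    grow : ∀ ρ → XL ρ ≡ true → XπL ρ ≡ true
    grow ρ e with X ρ | eqP π ρ
    ... | true | true  = refl
    ... | true | false = e
    cases : ∀ ρ → XπL ρ ≡ true → ρ ≡ π ⊎ XL ρ ≡ true
    cases ρ e with eqP π ρ in eq
    ... | true  = inj₁ (sym (eqP⇒≡ π ρ eq))
    ... | false = inj₂ e
    insert : ∀ b → X π ∧ not (member L π) ≡ b → FixBound i σ XπL
    insert true e = fixBound-insert XL XπL π π∉ π∈ grow cases (fixBound-member i σ X L)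
      where
      π∉ : XL π ≡ false
      π∉ with X π | member L π
      ... | true | false = refl
      π∈ : XπL π ≡ true
      π∈ = ∧-true⁺ (proj₁ (∧-true⁻ e)) (cong (_∨ member L π) (eqP-refl π))
    insert false e = fixBound-cong shrink grow (fixBound-member i σ X L)
      where
      shrink : ∀ ρ → XπL ρ ≡ true → XL ρ ≡ true
      shrink ρ e′ with cases ρ e′
      ... | inj₂ x    = x
      ... | inj₁ refl with X π | member L π
      ... | true | true = refl

  -- The fixing hypothesis, summed over all projections in `X`. There are finitely many, so they are
  -- inserted one by one from a complete list.
  Pr-fixInto : ∀ i σ (X : Event) → FixBound i σ X
  Pr-fixInto i σ X = fixBound-cong (λ π e → ∧-true⁺ e (∈⇒member (∈-projections π)))
    (λ π e → proj₁ (∧-true⁻ e)) (fixBound-member i σ X (projections n m))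

  -- A Khrapchenko bound for fixing projections

  Q : ℚ
  Q = q0 * q1

  Q≥0 : 0ℚ ≤ Q
  Q≥0 = *-≥0 0≤q0 0≤q1

  Qℕ≥0 : ∀ a → 0ℚ ≤ Q * ℕtoℚ a
  Qℕ≥0 a = *-≥0 Q≥0 (ℕtoℚ≥0 a)

  Pr-split : ∀ (U F : Event) → Pr d (λ p → U p ∧ F p) + Pr d (λ p → U p ∧ not (F p)) ≤ Pr d U
  Pr-split U F = Pr-disjoint 0≤d (λ p e → proj₁ (∧-true⁻ e)) (λ p e → proj₁ (∧-true⁻ e)) disjoint
    where
    disjoint : ∀ p → U p ∧ F p ≡ true → U p ∧ not (F p) ≡ true → ⊥
    disjoint p e e′ with U p | F p
    ... | true | true  = true≢false e′ refl
    ... | true | false = true≢false e refl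

  -- Edges between `U` and `V` are divided between the two inputs; Cauchy-Schwarz makes the sizes
  -- add while the products of probabilities add up to at most `w`.
  khrapchenko-gate : ∀ {X X₁ X₂ w w₁ w₂} a b → 0ℚ ≤ X → 0ℚ ≤ w₁ → 0ℚ ≤ w₂ →
    X ≤ X₁ + X₂ → w₁ + w₂ ≤ w → X₁ * X₁ ≤ Q * ℕtoℚ a * w₁ → X₂ * X₂ ≤ Q * ℕtoℚ b * w₂ →
    X * X ≤ Q * ℕtoℚ (a ℕ.+ b) * w
  khrapchenko-gate {X} {X₁} {X₂} {w} {w₁} {w₂} a b 0≤X 0≤w₁ 0≤w₂ X≤ ≤w X₁² X₂² = begin
    X * X                                        ≤⟨ *-mono 0≤X (≤-trans 0≤X X≤) X≤ X≤ ⟩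
    (X₁ + X₂) * (X₁ + X₂)                        ≤⟨ cauchy-schwarz X₁ X₂ (Qℕ≥0 a) (Qℕ≥0 b) 0≤w₁ 0≤w₂ X₁² X₂² ⟩
    (Q * ℕtoℚ a + Q * ℕtoℚ b) * (w₁ + w₂)        ≡⟨ cong (_* (w₁ + w₂)) (*-distribˡ-+ Q (ℕtoℚ a) (ℕtoℚ b)) ⟨
    Q * (ℕtoℚ a + ℕtoℚ b) * (w₁ + w₂)            ≡⟨ cong (λ s → Q * s * (w₁ + w₂)) (ℕtoℚ-+ a b) ⟨
    Q * ℕtoℚ (a ℕ.+ b) * (w₁ + w₂)               ≤⟨ *-monoˡ (Qℕ≥0 (a ℕ.+ b)) ≤w ⟩
    Q * ℕtoℚ (a ℕ.+ b) * w                       ∎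
    where open ≤-Reasoning

  -- Induction on `f`, where `f` separates `U` from `V`. An OR gate splits `U` and an AND gate
  -- splits `V`, so that each part is separated by one input. At a leaf, both fixings are fixings of
  -- x_i, and the two fixing bounds multiply to give `Q`.
  khrapchenko : ∀ J σ f (U V : Event) →
    (∀ π → U π ≡ true → at0 f π ≡ true) → (∀ π → V π ≡ true → at0 f π ≡ false) →
    Pr d (bothFix J σ U V) * Pr d (bothFix J σ U V) ≤ Q * ℕtoℚ (size f) * (Pr d U * Pr d V)
  khrapchenko J σ (leaf i r) U V U⇒1 V⇒0 = begin
    X * X
      ≤⟨ *-mono (Pr≥0 0≤d _) (*-≥0 (qσ≥0 (not σ)) (Pr≥0 0≤d V)) X≤U X≤V ⟩
    (qσ q0 q1 σ * Pr d U) * (qσ q0 q1 (not σ) * Pr d V)  ≡⟨ reorder σ (Pr d U) (Pr d V) ⟩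
    Q * 1ℚ * (Pr d U * Pr d V)                       ∎
    where
    open ≤-Reasoning
    X = Pr d (bothFix J σ U V)
    reorder : ∀ σ u v → (qσ q0 q1 σ * u) * (qσ q0 q1 (not σ) * v) ≡ Q * 1ℚ * (u * v)
    reorder true  = solve 4 (λ a b u v → (b :* u) :* (a :* v) := a :* b :* con 1ℚ :* (u :* v)) refl q0 q1
    reorder false = solve 4 (λ a b u v → (a :* u) :* (b :* v) := a :* b :* con 1ℚ :* (u :* v)) refl q0 q1
    value : ∀ p j τ {b} → at0 (leaf i r) (subst p j τ) ≡ b →
      litVal r (applyT (substT j τ (lookup p i)) (λ _ → false)) ≡ b
    value p j τ e rewrite sym (lookup-map i (substT j τ) p) = e
    into : ∀ p → bothFix J σ U V p ≡ true → fixInto i σ U p ≡ true × fixInto i (not σ) V p ≡ true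
    into p e with J p
    ... | just j with ∧-true⁻ e
    -- The leaf differs on the two fixings, so x_i is sent to a literal of the very variable chosen
    -- by `J`, and `fixInto` at `i` performs the same substitution.
    ... | u , v with separated⇒lit r (lookup p i) j {σ} {not σ} _ (value p j σ (U⇒1 _ u)) (value p j (not σ) (V⇒0 _ v))
    ... | s , eq rewrite eq = u , v
    X≤U : X ≤ qσ q0 q1 σ * Pr d U
    X≤U = ≤-trans (Pr-mono 0≤d (λ p e → proj₁ (into p e))) (Pr-fixInto i σ U)
    X≤V : X ≤ qσ q0 q1 (not σ) * Pr d V
    X≤V = ≤-trans (Pr-mono 0≤d (λ p e → proj₂ (into p e))) (Pr-fixInto i (not σ) V)
  khrapchenko J σ (or f g) U V U⇒1 V⇒0 =
    khrapchenko-gate {X₁ = Pr d (bothFix J σ U₁ V)} {Pr d (bothFix J σ U₂ V)} (size f) (size g)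
      (Pr≥0 0≤d _) (*-≥0 (Pr≥0 0≤d U₁) (Pr≥0 0≤d V)) (*-≥0 (Pr≥0 0≤d U₂) (Pr≥0 0≤d V))
      (Pr-union 0≤d (bothFix-cover J σ cover))
      (≤-trans (≤-reflexive (sym (*-distribʳ-+ (Pr d V) (Pr d U₁) (Pr d U₂)))) (*-monoʳ (Pr≥0 0≤d V) (Pr-split U (at0 f))))
      (khrapchenko J σ f U₁ V U₁⇒1 (λ π v → proj₁ (zeros π v)))
      (khrapchenko J σ g U₂ V U₂⇒1 (λ π v → proj₂ (zeros π v)))
    where
    U₁ U₂ : Event
    -- Where the OR gate is true, the first input is responsible if it is true, and the second
    -- otherwise.
    U₁ p = U p ∧ at0 f p
    U₂ p = U p ∧ not (at0 f p)
    cover : ∀ π ρ → U π ≡ true → V ρ ≡ true → (U₁ π ≡ true × V ρ ≡ true) ⊎ (U₂ π ≡ true × V ρ ≡ true)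
    cover π ρ u v with U π | at0 f π
    ... | true | true  = inj₁ (refl , v)
    ... | true | false = inj₂ (refl , v)
    U₁⇒1 : ∀ π → U₁ π ≡ true → at0 f π ≡ true
    U₁⇒1 π e = proj₂ (∧-true⁻ {U π} e)
    U₂⇒1 : ∀ π → U₂ π ≡ true → at0 g π ≡ true
    U₂⇒1 π e with U π in u | at0 f π in fπ
    ... | true | false = trans (sym (cong (_∨ at0 g π) fπ)) (U⇒1 π u)
    zeros : ∀ π → V π ≡ true → at0 f π ≡ false × at0 g π ≡ false
    zeros π v with at0 f π | at0 g π | V⇒0 π v
    ... | false | false | _ = refl , refl
  khrapchenko J σ (and f g) U V U⇒1 V⇒0 =
    khrapchenko-gate {X₁ = Pr d (bothFix J σ U V₁)} {Pr d (bothFix J σ U V₂)} (size f) (size g)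
      (Pr≥0 0≤d _) (*-≥0 (Pr≥0 0≤d U) (Pr≥0 0≤d V₁)) (*-≥0 (Pr≥0 0≤d U) (Pr≥0 0≤d V₂))
      (Pr-union 0≤d (bothFix-cover J σ cover))
      (≤-trans (≤-reflexive (sym (*-distribˡ-+ (Pr d U) (Pr d V₁) (Pr d V₂)))) (*-monoˡ (Pr≥0 0≤d U)
        (≤-trans (≤-reflexive (+-comm (Pr d V₁) (Pr d V₂))) (Pr-split V (at0 f)))))
      (khrapchenko J σ f U V₁ (λ π u → proj₁ (∧-true⁻ (U⇒1 π u))) V₁⇒0)
      (khrapchenko J σ g U V₂ (λ π u → proj₂ (∧-true⁻ {at0 f π} (U⇒1 π u))) V₂⇒0)
    where
    V₁ V₂ : Event
    -- Dually, where the AND gate is false, the first input is responsible if it is false.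
    V₁ p = V p ∧ not (at0 f p)
    V₂ p = V p ∧ at0 f p
    cover : ∀ π ρ → U π ≡ true → V ρ ≡ true → (U π ≡ true × V₁ ρ ≡ true) ⊎ (U π ≡ true × V₂ ρ ≡ true)
    cover π ρ u v with V ρ | at0 f ρ
    ... | true | true  = inj₂ (u , refl)
    ... | true | false = inj₁ (u , refl)
    V₁⇒0 : ∀ π → V₁ π ≡ true → at0 f π ≡ false
    V₁⇒0 π e with V π | at0 f π
    ... | true | false = refl
    V₂⇒0 : ∀ π → V₂ π ≡ true → at0 g π ≡ false
    V₂⇒0 π e with V π in v | at0 f π in fπ
    ... | true | true = trans (sym (cong (_∧ at0 g π) fπ)) (V⇒0 π v)

  -- Cut `A` into `U` and `V` by the value of `f`. When `f` becomes a literal of y_j, one fixing of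
  -- y_j lands in `U` and the other in `V`, so `khrapchenko` applies for each polarity.
  Pr-literal : ∀ f (J : Projection n m → Maybe (Fin m)) (A E : Event) →
    (∀ p → E p ≡ true → Σ (Fin m) λ j → Σ Bool λ r →
      (∀ a → restrict f p a ≡ litVal r (a j)) × J p ≡ just j × (∀ τ → A (subst p j τ) ≡ true)) →
    Pr d E * Pr d E ≤ Q * ℕtoℚ (size f) * (Pr d A * Pr d A)
  Pr-literal f J A E lit-f = begin
    Pr d E * Pr d E                       ≤⟨ *-mono (Pr≥0 0≤d E) (+-≥0 (Pr≥0 0≤d _) (Pr≥0 0≤d _)) E≤ E≤ ⟩
    (X true + X false) * (X true + X false)
      ≤⟨ cauchy-schwarz (X true) (X false) K≥0 K≥0 uv≥0 uv≥0 (X² true) (X² false) ⟩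
    (K + K) * (u * v + u * v)
      ≡⟨ solve 2 (λ K w → (K :+ K) :* (w :+ w) := K :* ((w :+ w) :+ (w :+ w))) refl K (u * v) ⟩
    -- The two polarities cost a factor 4, which 4uv ≤ (u+v)² absorbs because `U` and `V` are
    -- disjoint parts of `A`.
    K * quad (u * v)                      ≤⟨ *-monoˡ K≥0 (4xy≤[x+y]² u v) ⟩
    K * ((u + v) * (u + v))
      ≤⟨ *-monoˡ K≥0 (*-mono (+-≥0 (Pr≥0 0≤d U) (Pr≥0 0≤d V)) (Pr≥0 0≤d A) (Pr-split A (at0 f)) (Pr-split A (at0 f))) ⟩
    K * (Pr d A * Pr d A)                 ∎
    where
    open ≤-Reasoning
    U V : Event
    U p = A p ∧ at0 f p
    V p = A p ∧ not (at0 f p)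
    u = Pr d U
    v = Pr d V
    K = Q * ℕtoℚ (size f)
    K≥0 : 0ℚ ≤ K
    K≥0 = Qℕ≥0 (size f)
    uv≥0 : 0ℚ ≤ u * v
    uv≥0 = *-≥0 (Pr≥0 0≤d U) (Pr≥0 0≤d V)
    X : Bool → ℚ
    X σ = Pr d (bothFix J σ U V)
    X² : ∀ σ → X σ * X σ ≤ K * (u * v)
    X² σ = khrapchenko J σ f U V (λ π e → proj₂ (∧-true⁻ {A π} e)) V⇒0
      where
      V⇒0 : ∀ π → V π ≡ true → at0 f π ≡ false
      V⇒0 π e with A π | at0 f π
      ... | true | false = refl
    litVal-self : ∀ r → litVal r r ≡ true
    litVal-self true  = refl
    litVal-self false = refl
    not-litVal-not : ∀ r → not (litVal r (not r)) ≡ true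
    not-litVal-not true  = refl
    not-litVal-not false = refl
    pick : ∀ r {p} → bothFix J r U V p ≡ true → bothFix J true U V p ≡ true ⊎ bothFix J false U V p ≡ true
    pick true  = inj₁
    pick false = inj₂
    -- Setting y_j to the polarity `r` makes the literal true, so `σ` is `r`.
    hit : ∀ p j r → (∀ a → restrict f p a ≡ litVal r (a j)) → J p ≡ just j →
      (∀ τ → A (subst p j τ) ≡ true) → bothFix J r U V p ≡ true
    hit p j r f≡ J≡ inA rewrite J≡ = ∧-true⁺
      (∧-true⁺ (inA r) (trans (value r) (litVal-self r)))
      (∧-true⁺ (inA (not r)) (trans (cong not (value (not r))) (not-litVal-not r)))
      where
      value : ∀ τ → at0 f (subst p j τ) ≡ litVal r τ
      value τ = trans (restrict-subst f p j τ _) (trans (f≡ _) (cong (litVal r) (update-same _ j τ)))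
    E≤ : Pr d E ≤ X true + X false
    E≤ = Pr-union 0≤d λ p e → let (j , r , f≡ , J≡ , inA) = lit-f p e in pick r (hit p j r f≡ J≡ inA)

  -- Expected weight of the simplified formula

  module _ (total : totalWeight d ≡ 1ℚ) where

    Pr≤1 : ∀ E → Pr d E ≤ 1ℚ
    Pr≤1 E = ≤-trans (Pr≤totalWeight 0≤d E) (≤-reflexive total)

    literalProb bigProb : Formula n → ℚ
    literalProb f = Pr d (λ p → isLiteral (simp f p))
    bigProb     f = Pr d (λ p → isBig (simp f p))

    meanWeight : Formula n → ℚ
    meanWeight f = Exp d (λ p → weight (simp f p))

    badProb : Bool → Formula n → Formula n → ℚ
    badProb b f g = Pr d (λ p → badPair b (simp f p) (simp g p))

    -- `Pr-literal` with the certain event as `A`.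
    literalProb² : ∀ f → literalProb f * literalProb f ≤ Q * ℕtoℚ (size f)
    literalProb² f = begin
      literalProb f * literalProb f
        ≤⟨ Pr-literal f (λ p → literalVar (simp f p)) (λ _ → true) _ spec ⟩
      Q * ℕtoℚ (size f) * (Pr d (λ _ → true) * Pr d (λ _ → true))
        ≤⟨ *-monoˡ (Qℕ≥0 (size f)) (*-mono (Pr≥0 0≤d _) (nonNegative⁻¹ 1ℚ) (Pr≤1 _) (Pr≤1 _)) ⟩
      Q * ℕtoℚ (size f) * 1ℚ                        ≡⟨ *-identityʳ (Q * ℕtoℚ (size f)) ⟩
      Q * ℕtoℚ (size f)                             ∎
      where
      open ≤-Reasoning
      spec : ∀ p → isLiteral (simp f p) ≡ true → _
      spec p e = let (j , r , f≡ , J≡) = isLiteral-sound (simp f p) e in j , r , f≡ , J≡ , λ _ → refl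

    -- A probability is at least its square, and a form that is not a literal or constant has weight
    -- at least 1. The squared form is the one `gate-bound` takes.
    bigProb² : ∀ f → bigProb f * bigProb f ≤ meanWeight f
    bigProb² f = begin
      bigProb f * bigProb f   ≤⟨ *-monoʳ (Pr≥0 0≤d _) (Pr≤1 _) ⟩
      1ℚ * bigProb f          ≡⟨ *-identityˡ (bigProb f) ⟩
      bigProb f               ≡⟨ Exp-bit d _ ⟨
      Exp d (λ p → bit (isBig (simp f p))) ≤⟨ Exp-mono 0≤d (λ p → isBig≤weight (simp f p)) ⟩
      meanWeight f            ∎
      where open ≤-Reasoning

    -- Here `A` is "`g` is nonconstant": independence of y_j carries nonconstancy over to both
    -- fixings.
    badProb² : ∀ b f g → badProb b f g * badProb b f g ≤
      Q * ℕtoℚ (size f) * (Pr d (λ p → isNonconstant (simp g p)) * Pr d (λ p → isNonconstant (simp g p)))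
    badProb² b f g = Pr-literal f (λ p → literalVar (simp f p)) (λ p → isNonconstant (simp g p)) _ spec
      where
      spec : ∀ p → badPair b (simp f p) (simp g p) ≡ true → _
      spec p e =
        let (lit-f , nonconst , indep) = badPair-sound b (simp f p) (simp g p) e
            (j , r , f≡ , J≡)          = isLiteral-sound (simp f p) lit-f
        in j , r , f≡ , J≡ , λ τ → ¬Constant⇒isNonconstant (simp g (subst p j τ))
             (λ c → nonconst (independent-subst g p (indep J≡) τ c))

    2badProb≤ : ∀ b f g {D} → 0ℚ ≤ D → meanWeight g ≤ Q * D * D * ℕtoℚ (size g) →
      badProb b f g + badProb b f g ≤ Q * (ℕtoℚ (size f) + ℕtoℚ (size g)) * (1ℚ + D)
    2badProb≤ b f g 0≤D IH = gate-bound {X = badProb b f g} {l = literalProb g} {bigProb g}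
      Q≥0 0≤D (ℕtoℚ≥0 (size f)) (ℕtoℚ≥0 (size g)) (Pr≥0 0≤d _)
      (badProb² b f g) (Pr-union 0≤d (λ p → nonconstant⇒literal⊎big (simp g p)))
      (literalProb² g) (≤-trans (bigProb² g) IH)

    meanWeight-gate : ∀ b f g D {w : Projection n m → ℕ} →
      (∀ p → w p ℕ.≤ (weight (simp f p) ℕ.+ weight (simp g p))
                     ℕ.+ (bit (badPair b (simp f p) (simp g p)) ℕ.+ bit (badPair b (simp g p) (simp f p)))) →
      meanWeight f ≤ Q * ℕtoℚ D * ℕtoℚ D * ℕtoℚ (size f) →
      meanWeight g ≤ Q * ℕtoℚ D * ℕtoℚ D * ℕtoℚ (size g) →
      Exp d w ≤ Q * ℕtoℚ (1 ℕ.+ D) * ℕtoℚ (1 ℕ.+ D) * ℕtoℚ (size f ℕ.+ size g)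
    meanWeight-gate b f g D {w} w≤ IHf IHg = begin
      Exp d w                                                  ≤⟨ Exp-mono 0≤d w≤ ⟩
      Exp d (λ p → (Wf p ℕ.+ Wg p) ℕ.+ (Bf p ℕ.+ Bg p))
        ≡⟨ Exp-+ d (λ p → Wf p ℕ.+ Wg p) (λ p → Bf p ℕ.+ Bg p) ⟩
      Exp d (λ p → Wf p ℕ.+ Wg p) + Exp d (λ p → Bf p ℕ.+ Bg p)
        ≡⟨ cong₂ _+_ (Exp-+ d Wf Wg) (trans (Exp-+ d Bf Bg) (cong₂ _+_ (Exp-bit d _) (Exp-bit d _))) ⟩
      (meanWeight f + meanWeight g) + (badProb b f g + badProb b g f) ≤⟨ +-mono-≤ (+-mono-≤ IHf IHg) bad≤ ⟩
      (Q * δ * δ * s + Q * δ * δ * t) + Q * (s + t) * (1ℚ + δ)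
        ≤⟨ x≤x+y _ (*-≥0 (*-≥0 Q≥0 (ℕtoℚ≥0 D)) (+-≥0 (ℕtoℚ≥0 (size f)) (ℕtoℚ≥0 (size g)))) ⟩
      -- The added slack Q δ (s+t) completes the square, since δ² + (1 + δ) + δ = (1 + δ)².
      (Q * δ * δ * s + Q * δ * δ * t) + Q * (s + t) * (1ℚ + δ) + Q * δ * (s + t)
        ≡⟨ solve 4 (λ Q D s t → (Q :* D :* D :* s :+ Q :* D :* D :* t) :+ Q :* (s :+ t) :* (con 1ℚ :+ D) :+ Q :* D :* (s :+ t)
                     := Q :* (con 1ℚ :+ D) :* (con 1ℚ :+ D) :* (s :+ t)) refl Q δ s t ⟩
      Q * (1ℚ + δ) * (1ℚ + δ) * (s + t)
        ≡⟨ cong₂ (λ D s → Q * D * D * s) (ℕtoℚ-+ 1 D) (ℕtoℚ-+ (size f) (size g)) ⟨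
      Q * ℕtoℚ (1 ℕ.+ D) * ℕtoℚ (1 ℕ.+ D) * ℕtoℚ (size f ℕ.+ size g) ∎
      where
      open ≤-Reasoning
      δ = ℕtoℚ D
      s = ℕtoℚ (size f)
      t = ℕtoℚ (size g)
      Wf Wg Bf Bg : Projection n m → ℕ
      Wf p = weight (simp f p)
      Wg p = weight (simp g p)
      Bf p = bit (badPair b (simp f p) (simp g p))
      Bg p = bit (badPair b (simp g p) (simp f p))
      bad≤ : badProb b f g + badProb b g f ≤ Q * (s + t) * (1ℚ + δ)
      -- Each input can be the literal; each doubled bound gives the same right side, so their sum
      -- is twice what is wanted.
      bad≤ = double-cancel-≤ (≤-trans
        (≤-reflexive (interchange (badProb b f g) (badProb b g f) (badProb b f g) (badProb b g f)))
        (+-mono-≤ (2badProb≤ b f g (ℕtoℚ≥0 D) IHg)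
          (≤-trans (2badProb≤ b g f (ℕtoℚ≥0 D) IHf) (≤-reflexive (cong (λ x → Q * x * (1ℚ + δ)) (+-comm t s))))))

    -- The depth is relaxed to any upper bound `D`, so that both inputs of a gate use the same value
    -- in the induction.
    meanWeight≤ : ∀ f {D} → depth f ℕ.≤ D → meanWeight f ≤ Q * ℕtoℚ D * ℕtoℚ D * ℕtoℚ (size f)
    meanWeight≤ (leaf i r) {D} _ = ≤-trans (≤-reflexive (Exp-zero d (weight-leaf i r)))
      (*-≥0 (*-≥0 (Qℕ≥0 D) (ℕtoℚ≥0 D)) (ℕtoℚ≥0 1))
    meanWeight≤ (and f g) {ℕ.suc D} (s≤s ≤D) = meanWeight-gate true f g D
      (λ p → proj₂ (combine true (restrict-ext (and f g) p) (λ _ → refl) (simp f p) (simp g p)))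
      (meanWeight≤ f (ℕ.m⊔n≤o⇒m≤o (depth f) (depth g) ≤D)) (meanWeight≤ g (ℕ.m⊔n≤o⇒n≤o (depth f) (depth g) ≤D))
    meanWeight≤ (or f g) {ℕ.suc D} (s≤s ≤D) = meanWeight-gate false f g D
      (λ p → proj₂ (combine false (restrict-ext (or f g) p) (λ _ → refl) (simp f p) (simp g p)))
      (meanWeight≤ f (ℕ.m⊔n≤o⇒m≤o (depth f) (depth g) ≤D)) (meanWeight≤ g (ℕ.m⊔n≤o⇒n≤o (depth f) (depth g) ≤D))

    Exp-L≤ : ∀ f (Lval : Projection n m → ℕ) → (∀ π → IsL (restrict f π) (Lval π)) →
      Exp d Lval ≤ Q * ℕtoℚ (depth f) * ℕtoℚ (depth f) * ℕtoℚ (size f) + literalProb f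
    Exp-L≤ f Lval isL = begin
      Exp d Lval
        ≤⟨ Exp-mono 0≤d (λ p → IsL≤ (isL p) (simp f p)) ⟩
      Exp d (λ p → weight (simp f p) ℕ.+ bit (isLiteral (simp f p)))
        ≡⟨ Exp-+ d _ (λ p → bit (isLiteral (simp f p))) ⟩
      meanWeight f + Exp d (λ p → bit (isLiteral (simp f p)))
        ≡⟨ cong (meanWeight f +_) (Exp-bit d (λ p → isLiteral (simp f p))) ⟩
      meanWeight f + literalProb f
        ≤⟨ +-monoˡ-≤ (literalProb f) (meanWeight≤ f ℕ.≤-refl) ⟩
      Q * ℕtoℚ (depth f) * ℕtoℚ (depth f) * ℕtoℚ (size f) + literalProb f ∎
      where open ≤-Reasoning

theorem3p6 : Σ ℚ λ C →
    ∀ (n m : ℕ) (φ : Formula n) (d : Dist n m) (q0 q1 : ℚ) →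
    0ℚ ≤ q0 → q0 ≤ 1ℚ → 0ℚ ≤ q1 → q1 ≤ 1ℚ →
    IsDist d → Fixing q0 q1 d →
    (Lval : Projection n m → ℕ) → (∀ π → IsL (restrict φ π) (Lval π)) →
    Σ ℚ λ t → 0ℚ ≤ t × t * t ≤ q0 * q1 * ℕtoℚ (size φ) ×
    Exp d Lval ≤ C * (q0 * q1 * ℕtoℚ (depth φ) * ℕtoℚ (depth φ) * ℕtoℚ (size φ) + t)
-- The constant is 1. As q√s may be irrational, the literal probability `t` stands in for it and is
-- bounded through its square.
theorem3p6 = 1ℚ , λ n m φ d q0 q1 0≤q0 _ 0≤q1 _ (0≤d , total) fixing Lval isL →
  literalProb 0≤d 0≤q0 0≤q1 fixing total φ ,
  Pr≥0 0≤d _ ,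
  literalProb² 0≤d 0≤q0 0≤q1 fixing total φ ,
  ≤-trans (Exp-L≤ 0≤d 0≤q0 0≤q1 fixing total φ Lval isL) (≤-reflexive (sym (*-identityˡ _)))
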